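{- Let $J$ be a finite index set and for each $j\in J$ let $\Lambda_j\subset[0,2]$ be a finite multiset of numbers. Let $G$ and $G_j$ ($j\in J$) be finite simple graphs without isolated vertices such that: (a) $G_j\preccurlyeq_{t'_j} G\preccurlyeq_{t''_j} G_j$ for some $t'_j,t''_j\in\mathbb N_0$, and set $t_j:=t'_j+t''_j$; (b) $\Lambda_j$ has multiplicity $\mu_j$ in the spectrum of the standard Laplacian of $G_j$, with $\mu_j>t_j$; (c) the sets $\Lambda_j$, $j\in J$, are pairwise disjoint; (d) $|G|=\sum_{j\in J}(\mu_j-t_j)\,|\Lambda_j|$ (where $|\Lambda_j|$ counts elements with multiplicity). Then the spectrum of the standard Laplacian of $G$ (as a multiset) equals $\biguplus_{j\in J}\Lambda_j^{(\mu_j-t_j)}$, i.e. each element of $\Lambda_j$ occurring $s$ times in $\Lambda_j$ occurs exactly $s(\mu_j-t_j)$ times in the spectrum of $G$, and there are no other eigenvalues. The same statement holds for the signless standard Laplacians.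
   Context: All graphs are finite, simple, without isolated vertices; $|G|$ is the number of vertices. The standard Laplacian is $(\Delta_G f)(v)=f(v)-\frac{1}{\deg v}\sum_{u\in N_v}f(u)$ and the signless one $(\Delta_{G^+}f)(v)=f(v)+\frac{1}{\deg v}\sum_{u\in N_v}f(u)$ (equivalently the matrices $I\mp D^{ -1/2}AD^{ -1/2}$); their eigenvalues in ascending order with multiplicity are $\lambda_1(G)\le\dots\le\lambda_{|G|}(G)$, and spectra lie in $[0,2]$. Spectral preorder: $G\preccurlyeq_t G'$ ($t\in\mathbb N_0$) means $|G|\ge|G'|-t$ and $\lambda_k(G)\le\lambda_{k+t}(G')$ for all $1\le k\le|G'|-t$. A multiset $\Lambda$ has multiplicity $\mu$ in a spectrum $\sigma$ if each element of $\Lambda$ having multiplicity $s$ in $\Lambda$ has multiplicity at least $s\mu$ in $\sigma$; this is written $\Lambda^{(\mu)}\subset\sigma$, and $\Lambda^{(\mu)}$ denotes $\Lambda$ with all multiplicities multiplied by $\mu$; $\biguplus$ is the multiset union. -}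

module Defs where

open import Algebra.Bundles using (CommutativeRing)
open import Algebra.Structures using (IsCommutativeRing)
open import Data.Fin.Base using (Fin; toℕ)
open import Data.List.Base using (List; allFin; concat; filter; foldr; length; map; replicate; tabulate)
open import Data.Nat.Base as ℕ using (ℕ)
open import Data.Product.Base using (_×_; ∃; ∃-syntax)
open import Data.Vec.Functional using (Vector)
open import Level using (Level; _⊔_; 0ℓ) renaming (suc to lsuc)
open import Relation.Binary.Bundles using (DecTotalOrder; Setoid)
open import Relation.Binary.Core using (Rel)
open import Relation.Binary.Definitions using (Decidable; Irreflexive; Symmetric)
open import Relation.Binary.PropositionalEquality.Core using (_≡_)
open import Relation.Binary.Structures using (IsDecTotalOrder)
open import Relation.Nullary.Negation.Core using (¬_)
open import Relation.Unary using (Pred; Satisfiable)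

-- The classical real numbers, given axiomatically as a Dedekind-complete
-- ordered field.  Classical logic enters only here: equality and order of
-- reals are decidable and every bounded inhabited predicate has a supremum.
record RealNumbers (c ℓ₁ ℓ₂ : Level) : Set (lsuc (c ⊔ ℓ₁ ⊔ ℓ₂)) where
  infix  4 _≈_ _≤_
  infix  8 -_
  infixl 7 _*_
  infixl 6 _+_
  field
    Carrier : Set c
    _≈_     : Rel Carrier ℓ₁
    _≤_     : Rel Carrier ℓ₂
    _+_     : Carrier → Carrier → Carrier
    _*_     : Carrier → Carrier → Carrier
    -_      : Carrier → Carrier
    0#      : Carrier
    1#      : Carrier
    -- Total; nothing is assumed about the value at 0#.
    inv     : Carrier → Carrier

    isCommutativeRing : IsCommutativeRing _≈_ _+_ _*_ -_ 0# 1#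
    0≉1               : ¬ (0# ≈ 1#)
    inv-inverse       : ∀ x → ¬ (x ≈ 0#) → x * inv x ≈ 1#

    isDecTotalOrder   : IsDecTotalOrder _≈_ _≤_
    +-monoʳ-≤         : ∀ x {y z} → y ≤ z → x + y ≤ x + z
    *-nonNeg          : ∀ {x y} → 0# ≤ x → 0# ≤ y → 0# ≤ x * y

  UpperBound : Pred Carrier (c ⊔ ℓ₁ ⊔ ℓ₂) → Pred Carrier (c ⊔ ℓ₁ ⊔ ℓ₂)
  UpperBound P b = ∀ x → P x → x ≤ b

  field
    supremum : ∀ (P : Pred Carrier (c ⊔ ℓ₁ ⊔ ℓ₂)) →
               Satisfiable P → Satisfiable (UpperBound P) →
               ∃[ s ] UpperBound P s × (∀ b → UpperBound P b → s ≤ b)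

  commutativeRing : CommutativeRing c ℓ₁
  commutativeRing = record { isCommutativeRing = isCommutativeRing }

  decTotalOrder : DecTotalOrder c ℓ₁ ℓ₂
  decTotalOrder = record { isDecTotalOrder = isDecTotalOrder }

  setoid : Setoid c ℓ₁
  setoid = CommutativeRing.setoid commutativeRing

  open IsDecTotalOrder isDecTotalOrder public using (_≟_; _≤?_)

record Graph : Set₁ where
  field
    ∣V∣        : ℕ
    Adj        : Rel (Fin ∣V∣) 0ℓ
    adj?       : Decidable Adj
    symmetric  : Symmetric Adj
    loopless   : Irreflexive _≡_ Adj
    noIsolated : ∀ v → ∃[ u ] Adj v u

  neighbours : Fin ∣V∣ → List (Fin ∣V∣)
  neighbours v = filter (adj? v) (allFin ∣V∣)

  deg : Fin ∣V∣ → ℕ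
  deg v = length (neighbours v)

open Graph public using (∣V∣)

data LaplacianKind : Set where
  standard signless : LaplacianKind

module OverReals {c ℓ₁ ℓ₂ : Level} (R : RealNumbers c ℓ₁ ℓ₂) where
  open RealNumbers R
  open import Algebra.Definitions.RawMonoid
    (CommutativeRing.+-rawMonoid commutativeRing) using (sum) renaming (_×_ to _×ℕ_)
  open import Data.List.Membership.Setoid setoid using (_∈_) public
  open import Data.List.Relation.Binary.Disjoint.Setoid setoid using (Disjoint) public
  open import Data.List.Relation.Binary.Permutation.Setoid setoid using (_↭_) public

  fromℕ : ℕ → Carrier
  fromℕ n = n ×ℕ 1#

  InInterval02 : Pred Carrier ℓ₂
  InInterval02 x = 0# ≤ x × x ≤ fromℕ 2

  -- Finite multisets of reals are lists, considered up to permutation.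

  multiplicity : Carrier → List Carrier → ℕ
  multiplicity x xs = length (filter (x ≟_) xs)

  -- Λ ⟨ μ ⟩ is Λ^(μ): all multiplicities multiplied by μ.
  _⟨_⟩ : List Carrier → ℕ → List Carrier
  Λ ⟨ μ ⟩ = concat (replicate μ Λ)

  -- Λ^(μ) ⊂ σ
  HasMultiplicityIn : List Carrier → ℕ → List Carrier → Set (c ⊔ ℓ₁)
  HasMultiplicityIn Λ μ σ =
    ∀ x → x ∈ Λ → multiplicity x Λ ℕ.* μ ℕ.≤ multiplicity x σ

  ⨄ : ∀ {m : ℕ} → (Fin m → List Carrier) → List Carrier
  ⨄ Λ = concat (tabulate Λ)

  Subspace : ℕ → Set (c ⊔ lsuc ℓ₁)
  Subspace n = Pred (Vector Carrier n) ℓ₁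

  combination : ∀ {n d : ℕ} → Vector Carrier d → (Fin d → Vector Carrier n) → Vector Carrier n
  combination a b v = sum (λ i → a i * b i v)

  record HasDimension {n : ℕ} (S : Subspace n) (d : ℕ) : Set (c ⊔ ℓ₁) where
    field
      basis       : Fin d → Vector Carrier n
      inSubspace  : ∀ i → S (basis i)
      independent : ∀ a → (∀ v → combination a basis v ≈ 0#) → ∀ i → a i ≈ 0#
      spanning    : ∀ f → S f → ∃[ a ] (∀ v → f v ≈ combination a basis v)

  neighbourAverage : (G : Graph) → Vector Carrier (∣V∣ G) → Vector Carrier (∣V∣ G)
  neighbourAverage G f v = inv (fromℕ (deg v)) * foldr _+_ 0# (map f (neighbours v))
    where open Graph G using (deg; neighbours)

  Δ : LaplacianKind → (G : Graph) → Vector Carrier (∣V∣ G) → Vector Carrier (∣V∣ G)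
  Δ standard G f v = f v + - neighbourAverage G f v
  Δ signless G f v = f v +   neighbourAverage G f v

  Eigenspace : (κ : LaplacianKind) (G : Graph) → Carrier → Subspace (∣V∣ G)
  Eigenspace κ G x f = ∀ v → Δ κ G f v ≈ x * f v

  -- The |G| eigenvalues in ascending order, each repeated according to the
  -- dimension of its eigenspace.  Over the reals such an enumeration exists
  -- (Δ is self-adjoint for the degree-weighted inner product) and is unique
  -- up to _≈_, so a term of this type is the spectrum of G.
  record Spectrum (κ : LaplacianKind) (G : Graph) : Set (c ⊔ ℓ₁ ⊔ ℓ₂) where
    field
      eigenvalue : Fin (∣V∣ G) → Carrier
      ascending  : ∀ {k l} → toℕ k ℕ.≤ toℕ l → eigenvalue k ≤ eigenvalue l

    eigenvalues : List Carrier
    eigenvalues = tabulate eigenvalue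

    field
      multiplicity-dim : ∀ x → HasDimension (Eigenspace κ G x) (multiplicity x eigenvalues)

  open Spectrum public using (eigenvalue; eigenvalues)

  -- G ≼_t G'.  The second component is λ_k(G) ≤ λ_{k+t}(G') for every k
  -- such that both indices are in range; by the first component these are
  -- exactly 1 ≤ k ≤ |G'| − t.
  SpectrallyPrecedes : {κ : LaplacianKind} {G G' : Graph} →
                       Spectrum κ G → ℕ → Spectrum κ G' → Set ℓ₂
  SpectrallyPrecedes {G = G} {G'} σ t σ' =
    (∣V∣ G' ℕ.≤ ∣V∣ G ℕ.+ t) ×
    (∀ (k : Fin (∣V∣ G)) (l : Fin (∣V∣ G')) → toℕ l ≡ toℕ k ℕ.+ t →
       eigenvalue σ k ≤ eigenvalue σ' l)

  syntax SpectrallyPrecedes σ t σ' = σ ≼[ t ] σ'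

-- Write N<(H), N≤(H) for the number of eigenvalues of H below x, respectively
-- not above x.  H ≼_t H' says that deleting the first t eigenvalues of H' and
-- pairing off the rest makes those of H the smaller ones, so
-- N<(H') ≤ t + N<(H) and N≤(H') ≤ t + N≤(H).  As mult_H(x) = N≤(H) − N<(H), the
-- two comparisons of G with Gⱼ give mult_{Gⱼ}(x) ≤ tⱼ + mult_G(x).  Hence the
-- multiset ⨄ Λⱼ^(μⱼ−tⱼ) is contained in the spectrum of G, and both have the
-- same cardinality.
module Submission where

open import Defs
open import Algebra.Bundles using (module CommutativeRing)
open import Data.Bool.Base using (true; false)
open import Data.Fin.Base using (Fin; zero; suc; toℕ)
open import Data.Fin.Properties using (suc-injective)
open import Data.List.Base
  using (List; []; _∷_; _++_; concat; filter; length; replicate; sum; tabulate)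
open import Data.List.Properties
  using (filter-++; filter-accept; filter-none; filter-some; length-++; length-tabulate; tabulate-cong)
open import Data.List.Relation.Unary.All using (All)
open import Data.List.Relation.Unary.All.Properties using (¬Any⇒All¬)
open import Data.List.Relation.Unary.Any using (any?)
open import Data.Nat.Base using (ℕ; zero; suc; _+_; _*_; _∸_; _≤_; _<_; z≤n; s≤s; s≤s⁻¹; pred; >-nonZero)
open import Data.Nat.Properties hiding (_≟_; _≤?_; suc-injective; ≤-antisym; ≤-total)
open import Data.Nat.Solver using (module +-*-Solver)
open import Data.Product.Base using (_,_)
open import Data.Sum.Base using (_⊎_; inj₁; inj₂)
open import Function.Base using (_∘_)
open import Level using (Level)
open import Relation.Binary.PropositionalEquality using (_≡_; _≢_; refl; sym; trans; cong; subst; module ≡-Reasoning)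
open import Relation.Binary.Structures using (module IsDecTotalOrder)
open import Relation.Nullary.Decidable using (yes; no; does; ¬?)
open import Relation.Nullary.Negation using (contradiction)
open import Relation.Unary using (Pred; Decidable)

-- Separation leaves at most one nonzero term, so the sum is that term or zero. The terms will be
-- the contributions of the several `Λ j` to the multiplicity of one number.
sum-tabulate-≤ : ∀ {m M} (f : Fin m → ℕ) → (∀ i → f i ≤ M) →
                 (∀ i j → i ≢ j → f i ≡ 0 ⊎ f j ≡ 0) → sum (tabulate f) ≤ M
sum-tabulate-≤ {zero}      f f≤M sep = z≤n
sum-tabulate-≤ {suc m} {M} f f≤M sep with f zero in eq
... | zero  = sum-tabulate-≤ (f ∘ suc) (f≤M ∘ suc)
                (λ i j i≢j → sep (suc i) (suc j) (i≢j ∘ suc-injective))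
... | suc k = begin
  suc k + sum (tabulate (f ∘ suc)) ≤⟨ +-monoʳ-≤ (suc k) rest≤0 ⟩
  suc k + 0                        ≡⟨ +-identityʳ (suc k) ⟩
  suc k                            ≡⟨ eq ⟨
  f zero                           ≤⟨ f≤M zero ⟩
  M                                ∎
  where
  open ≤-Reasoning
  vanishes : ∀ i → f (suc i) ≤ 0
  vanishes i with sep zero (suc i) (λ ())
  ... | inj₁ f0≡0 = contradiction (trans (sym f0≡0) eq) 0≢1+n
  ... | inj₂ fi≡0 = ≤-reflexive fi≡0
  rest≤0 : sum (tabulate (f ∘ suc)) ≤ 0
  -- The induction hypothesis is applied with bound 0; separation is immediate because every later
  -- term is zero.
  rest≤0 = sum-tabulate-≤ (f ∘ suc) vanishes (λ i _ _ → inj₁ (n≤0⇒n≡0 (vanishes i)))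

module _ {a} {A : Set a} (h : List A → ℕ)
         (h-[] : h [] ≡ 0) (h-++ : ∀ xs ys → h (xs ++ ys) ≡ h xs + h ys) where

  additive-replicate : ∀ n xs → h (concat (replicate n xs)) ≡ n * h xs
  additive-replicate zero    xs = h-[]
  additive-replicate (suc n) xs = trans (h-++ xs _) (cong (h xs +_) (additive-replicate n xs))

  additive-tabulate : ∀ {m} (f : Fin m → List A) →
                      h (concat (tabulate f)) ≡ sum (tabulate (h ∘ f))
  additive-tabulate {zero}  f = h-[]
  additive-tabulate {suc m} f =
    trans (h-++ (f zero) _) (cong (h (f zero) +_) (additive-tabulate (f ∘ suc)))

  -- Serves twice: with `multiplicity x` for `h` to count `x` in the union, and with `length` to
  -- match the union with the formula for the order of `G`.
  additive-weighted-union : ∀ {m} (w : Fin m → ℕ) (f : Fin m → List A) →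
    h (concat (tabulate (λ j → concat (replicate (w j) (f j))))) ≡
    sum (tabulate (λ j → w j * h (f j)))
  additive-weighted-union w f = trans (additive-tabulate (λ j → concat (replicate (w j) (f j))))
    (cong sum (tabulate-cong (λ j → additive-replicate (w j) (f j))))

module _ {a p} {A : Set a} {P : Pred A p} (P? : Decidable P) where

  count : List A → ℕ
  count xs = length (filter P? xs)

  count-++ : ∀ xs ys → count (xs ++ ys) ≡ count xs + count ys
  count-++ xs ys = trans (cong length (filter-++ P? xs ys)) (length-++ (filter P? xs))

  count-∷-≤ : ∀ x xs → count (x ∷ xs) ≤ suc (count xs)
  count-∷-≤ x xs with does (P? x)
  ... | true  = ≤-refl
  ... | false = n≤1+n _

  count-∷-mono : ∀ {x y xs ys} → (P x → P y) → count xs ≤ count ys →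
                 count (x ∷ xs) ≤ count (y ∷ ys)
  count-∷-mono {x} {y} Px⇒Py xs≤ys with P? x | P? y
  ... | yes _  | yes _  = s≤s xs≤ys
  ... | yes Px | no ¬Py = contradiction (Px⇒Py Px) ¬Py
  ... | no  _  | yes _  = m≤n⇒m≤1+n xs≤ys
  ... | no  _  | no  _  = xs≤ys

  -- Dropping the first `t` entries of `f` loses at most `t` from the count. By `n ≤ m + t` every
  -- remaining entry has a partner in `g`, to which `P` passes; surplus entries of `g` can only
  -- raise the right side.
  count-tabulate-≤ : ∀ t {n m} (f : Fin n → A) (g : Fin m → A) → n ≤ m + t →
    (∀ k l → toℕ l ≡ toℕ k + t → P (f l) → P (g k)) →
    count (tabulate f) ≤ t + count (tabulate g)
  count-tabulate-≤ t       {zero}  f g n≤m+t P⇒P = z≤n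
  count-tabulate-≤ (suc t) {suc n} {m} f g n≤m+t P⇒P =
    ≤-trans (count-∷-≤ (f zero) _) (s≤s (count-tabulate-≤ t (f ∘ suc) g
      (s≤s⁻¹ (subst (suc n ≤_) (+-suc m t) n≤m+t))
      (λ k l l≡k+t → P⇒P k (suc l) (trans (cong suc l≡k+t) (sym (+-suc (toℕ k) t))))))
  -- With no shift left, heads are paired with heads; an empty `g` is excluded by the size bound.
  count-tabulate-≤ zero {suc n} {suc m} f g n≤m+t P⇒P =
    count-∷-mono (P⇒P zero zero refl) (count-tabulate-≤ zero (f ∘ suc) (g ∘ suc) (s≤s⁻¹ n≤m+t)
      (λ k l l≡k+t → P⇒P (suc k) (suc l) (cong suc l≡k+t)))

-- The theorem removes `t` copies for each of the `s` occurrences in `Λ j`, whereas the comparison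
-- of spectra costs only `t` in total; `t ≤ s * t` since `s` is positive.
[m∸t]*s≤q : ∀ {m s p q} t → 0 < s → s * m ≤ p → p ≤ t + q → (m ∸ t) * s ≤ q
[m∸t]*s≤q {m} {s} {p} {q} t 0<s sm≤p p≤t+q = begin
  (m ∸ t) * s   ≡⟨ *-comm (m ∸ t) s ⟩
  s * (m ∸ t)   ≡⟨ *-distribˡ-∸ s m t ⟩
  s * m ∸ s * t ≤⟨ ∸-mono sm≤p (m≤n*m t s {{>-nonZero 0<s}}) ⟩
  p ∸ t         ≤⟨ m≤n+o⇒m∸n≤o p t p≤t+q ⟩
  q             ∎
  where open ≤-Reasoning

module _ {c ℓ₁ ℓ₂ : Level} (ℝ : RealNumbers c ℓ₁ ℓ₂) where
  open RealNumbers ℝ using (Carrier; _≈_; setoid; _≟_; _≤?_; isDecTotalOrder)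
    renaming (_≤_ to _≤ᴿ_)
  open OverReals ℝ
  open IsDecTotalOrder isDecTotalOrder
    using () renaming (reflexive to ≤ᴿ-reflexive; trans to ≤ᴿ-trans; antisym to ≤ᴿ-antisym; total to ≤ᴿ-total)
  open CommutativeRing (RealNumbers.commutativeRing ℝ) using ()
    renaming (refl to ≈-refl; sym to ≈-sym; trans to ≈-trans)
  open import Data.List.Membership.Setoid setoid using (_∉_)
  open import Data.List.Membership.Setoid.Properties using (∈-∃++)
  open import Data.List.Relation.Binary.Permutation.Setoid setoid
    using (↭-trans; ↭-sym; ↭-refl; prep; ↭-reflexive-≋)
  open import Data.List.Relation.Binary.Permutation.Setoid.Properties setoid
    using (shift; xs↭ys⇒|xs|≡|ys|; filter⁺)

  multiplicity-∉ : ∀ {x xs} → x ∉ xs → multiplicity x xs ≡ 0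
  multiplicity-∉ {x} x∉xs = cong length (filter-none (x ≟_) (¬Any⇒All¬ _ x∉xs))

  multiplicity>0⇒∈ : ∀ {x xs} → 0 < multiplicity x xs → x ∈ xs
  multiplicity>0⇒∈ {x} {xs} 0<mult with any? (x ≟_) xs
  ... | yes x∈xs = x∈xs
  ... | no  x∉xs = contradiction (sym (multiplicity-∉ x∉xs)) (<⇒≢ 0<mult)

  multiplicity-resp-↭ : ∀ x {xs ys} → xs ↭ ys → multiplicity x xs ≡ multiplicity x ys
  multiplicity-resp-↭ x xs↭ys =
    xs↭ys⇒|xs|≡|ys| (filter⁺ (x ≟_) (λ y≈z x≈y → ≈-trans x≈y y≈z) xs↭ys)

  multiplicity-drop-∷ : ∀ x y {xs ys} →
    multiplicity x (y ∷ xs) ≤ multiplicity x (y ∷ ys) → multiplicity x xs ≤ multiplicity x ys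
  multiplicity-drop-∷ x y le with does (x ≟ y)
  ... | true  = s≤s⁻¹ le
  ... | false = le

  -- A multiset contained in another of the same size equals it. Induction on `ys`: its head occurs
  -- in `xs`, is moved to the front there, and is cancelled on both sides.
  multiplicity-≤⇒↭ : ∀ xs ys → (∀ x → multiplicity x ys ≤ multiplicity x xs) →
                     length xs ≡ length ys → xs ↭ ys
  multiplicity-≤⇒↭ []       []       ys⊆xs eq = ↭-refl
  multiplicity-≤⇒↭ xs@(_ ∷ _) (y ∷ ys) ys⊆xs eq =
    ↭-trans xs↭y∷zs (prep ≈-refl (multiplicity-≤⇒↭ _ ys
      (λ x → multiplicity-drop-∷ x y
        (≤-trans (ys⊆xs x) (≤-reflexive (multiplicity-resp-↭ x xs↭y∷zs))))
      (cong pred (trans (sym (xs↭ys⇒|xs|≡|ys| xs↭y∷zs)) eq))))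
    where
    y∈xs : y ∈ xs
    y∈xs = multiplicity>0⇒∈ (≤-trans
      (subst (0 <_) (sym (cong length (filter-accept (y ≟_) {xs = ys} ≈-refl))) (s≤s z≤n)) (ys⊆xs y))
    zs : List Carrier
    zs = let as , bs , _ = ∈-∃++ setoid y∈xs in as ++ bs
    -- The entry found in `xs` is some `w` with `y ≈ w`, not `y` itself; `shift` replaces it while
    -- moving it.
    xs↭y∷zs : xs ↭ y ∷ zs
    xs↭y∷zs = let as , bs , _ , y≈w , xs≋ = ∈-∃++ setoid y∈xs in
      ↭-trans (↭-reflexive-≋ xs≋) (shift (≈-sym y≈w) as bs)

  -- y < x is written as ¬ (x ≤ y).
  count-≤ : ∀ x xs → count (_≤? x) xs ≡ count (λ y → ¬? (x ≤? y)) xs + multiplicity x xs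
  count-≤ x [] = refl
  count-≤ x (y ∷ ys) with y ≤? x | x ≤? y | x ≟ y
  ... | yes _   | yes _   | yes _   = trans (cong suc (count-≤ x ys)) (sym (+-suc _ _))
  ... | yes y≤x | yes x≤y | no  x≉y = contradiction (≤ᴿ-antisym x≤y y≤x) x≉y
  ... | yes _   | no  x≰y | yes x≈y = contradiction (≤ᴿ-reflexive x≈y) x≰y
  ... | yes _   | no  _   | no  _   = cong suc (count-≤ x ys)
  ... | no  y≰x | yes _   | yes x≈y = contradiction (≤ᴿ-reflexive (≈-sym x≈y)) y≰x
  ... | no  _   | yes _   | no  _   = count-≤ x ys
  ... | no  y≰x | no  x≰y | _ with ≤ᴿ-total x y
  ...   | inj₁ x≤y = contradiction x≤y x≰y
  ...   | inj₂ y≤x = contradiction y≤x y≰x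

  -- Each comparison is used at one end of the count: `τ ≼[ t' ] σ` for eigenvalues strictly below
  -- `x`, `σ ≼[ t'' ] τ` for those not above `x`.
  multiplicity-≼ : ∀ {κ G H} (σ : Spectrum κ G) (τ : Spectrum κ H) {t' t''} →
    τ ≼[ t' ] σ → σ ≼[ t'' ] τ →
    ∀ x → multiplicity x (eigenvalues τ) ≤ t' + t'' + multiplicity x (eigenvalues σ)
  multiplicity-≼ σ τ {t'} {t''} (|σ|≤ , τ≤σ) (|τ|≤ , σ≤τ) x =
    -- Adding `below τ` to both sides avoids writing a multiplicity as a truncated difference.
    +-cancelˡ-≤ (below τ) _ _ (begin
      below τ + multiplicity x (eigenvalues τ)                     ≡⟨ count-≤ x (eigenvalues τ) ⟨
      count (_≤? x) (eigenvalues τ)                                ≤⟨ upper ⟩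
      t'' + count (_≤? x) (eigenvalues σ)                          ≡⟨ cong (t'' +_) (count-≤ x (eigenvalues σ)) ⟩
      t'' + (below σ + multiplicity x (eigenvalues σ))             ≤⟨ +-monoʳ-≤ t'' (+-monoˡ-≤ _ lower) ⟩
      t'' + ((t' + below τ) + multiplicity x (eigenvalues σ))      ≡⟨ rearrange t'' t' (below τ) _ ⟩
      below τ + (t' + t'' + multiplicity x (eigenvalues σ))        ∎)
    where
    open ≤-Reasoning
    below : ∀ {κ G} → Spectrum κ G → ℕ
    below ρ = count (λ y → ¬? (x ≤? y)) (eigenvalues ρ)
    lower : below σ ≤ t' + below τ
    lower = count-tabulate-≤ (λ y → ¬? (x ≤? y)) t' (eigenvalue σ) (eigenvalue τ) |σ|≤
      (λ k l l≡k+t x≰σl x≤τk → x≰σl (≤ᴿ-trans x≤τk (τ≤σ k l l≡k+t)))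
    upper : count (_≤? x) (eigenvalues τ) ≤ t'' + count (_≤? x) (eigenvalues σ)
    upper = count-tabulate-≤ (_≤? x) t'' (eigenvalue τ) (eigenvalue σ) |τ|≤
      (λ k l l≡k+t τl≤x → ≤ᴿ-trans (σ≤τ k l l≡k+t) τl≤x)
    rearrange : ∀ a b c d → a + ((b + c) + d) ≡ c + (b + a + d)
    rearrange = solve 4 (λ a b c d → a :+ ((b :+ c) :+ d) := c :+ (b :+ a :+ d)) refl
      where open +-*-Solver

  -- Disjointness puts `x` in at most one `Λ j`, so the contributions do not accumulate and a bound
  -- for that one `Λ j` suffices.
  multiplicity-⨄-≤ : ∀ {m M} (Λ : Fin m → List Carrier) (w : Fin m → ℕ) x →
    (∀ i j → i ≢ j → Disjoint (Λ i) (Λ j)) →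
    (∀ j → x ∈ Λ j → w j * multiplicity x (Λ j) ≤ M) →
    multiplicity x (⨄ (λ j → Λ j ⟨ w j ⟩)) ≤ M
  multiplicity-⨄-≤ {M = M} Λ w x disjoint bound = begin
    multiplicity x (⨄ (λ j → Λ j ⟨ w j ⟩))              ≡⟨ additive-weighted-union (multiplicity x) refl (count-++ (x ≟_)) w Λ ⟩
    sum (tabulate (λ j → w j * multiplicity x (Λ j)))   ≤⟨ sum-tabulate-≤ _ bound′ separated ⟩
    M                                                   ∎
    where
    open ≤-Reasoning
    vanishes : ∀ j → x ∉ Λ j → w j * multiplicity x (Λ j) ≡ 0
    vanishes j x∉Λj = trans (cong (w j *_) (multiplicity-∉ x∉Λj)) (*-zeroʳ (w j))
    bound′ : ∀ j → w j * multiplicity x (Λ j) ≤ M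
    bound′ j with any? (x ≟_) (Λ j)
    ... | yes x∈Λj = bound j x∈Λj
    ... | no  x∉Λj = subst (_≤ M) (sym (vanishes j x∉Λj)) z≤n
    separated : ∀ i j → i ≢ j →
      w i * multiplicity x (Λ i) ≡ 0 ⊎ w j * multiplicity x (Λ j) ≡ 0
    separated i j i≢j with any? (x ≟_) (Λ i)
    ... | no  x∉Λi = inj₁ (vanishes i x∉Λi)
    ... | yes x∈Λi = inj₂ (vanishes j (λ x∈Λj → disjoint i j i≢j (x∈Λi , x∈Λj)))

mainTheorem2 :
    ∀ {c ℓ₁ ℓ₂ : Level} (ℝ : RealNumbers c ℓ₁ ℓ₂) →
    let open RealNumbers ℝ using (Carrier)
        open OverReals ℝ
    in
    ∀ (κ : LaplacianKind)
      {m : ℕ} (Λ : Fin m → List Carrier) (μ t' t'' : Fin m → ℕ)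
      (G : Graph) (Gⱼ : Fin m → Graph)
      (σ : Spectrum κ G) (σⱼ : ∀ j → Spectrum κ (Gⱼ j)) →
    let t : Fin m → ℕ
        t j = t' j + t'' j
    in
    (∀ j → All InInterval02 (Λ j)) →
    (∀ j → σⱼ j ≼[ t' j ] σ) →
    (∀ j → σ ≼[ t'' j ] σⱼ j) →
    (∀ j → HasMultiplicityIn (Λ j) (μ j) (eigenvalues (σⱼ j))) →
    (∀ j → t j < μ j) →
    (∀ i j → i ≢ j → Disjoint (Λ i) (Λ j)) →
    ∣V∣ G ≡ sum (tabulate (λ j → (μ j ∸ t j) * length (Λ j))) →
    eigenvalues σ ↭ ⨄ (λ j → Λ j ⟨ μ j ∸ t j ⟩)
mainTheorem2 ℝ κ Λ μ t' t'' G Gⱼ σ σⱼ _ σⱼ≼σ σ≼σⱼ Λ⊂σⱼ _ disjoint |G|≡ =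
  multiplicity-≤⇒↭ ℝ _ _
    (λ x → multiplicity-⨄-≤ ℝ Λ (λ j → μ j ∸ t j) x disjoint
      -- Membership in `Λ j` is used twice: it makes the multiplicity in `Λ j` positive, and it
      -- gives access to the multiplicity hypothesis on `Gⱼ j`.
      (λ j x∈Λj → [m∸t]*s≤q (t j) (filter-some (x ≟_) x∈Λj) (Λ⊂σⱼ j x x∈Λj)
        (multiplicity-≼ ℝ σ (σⱼ j) (σⱼ≼σ j) (σ≼σⱼ j) x)))
    (begin
      length (eigenvalues σ)                             ≡⟨ length-tabulate (eigenvalue σ) ⟩
      ∣V∣ G                                              ≡⟨ |G|≡ ⟩
      sum (tabulate (λ j → (μ j ∸ t j) * length (Λ j)))  ≡⟨ additive-weighted-union length refl (λ xs _ → length-++ xs) (λ j → μ j ∸ t j) Λ ⟨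
      length (⨄ (λ j → Λ j ⟨ μ j ∸ t j ⟩))               ∎)
  where
  open RealNumbers ℝ using (_≟_)
  open OverReals ℝ
  open ≡-Reasoning
  t : _ → ℕ
  t j = t' j + t'' j
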